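{- Let $n\ge1$ and let $F:\mathbb{R}^n\to\mathbb{R}^{n+1}\to\mathbb{R}$ be a ReLU neural network with input dimension $n$ and a single hidden layer of dimension $n+1$. Let $t\in\mathbb{R}$ be a transversal threshold for $F$. Then each of the decision regions $Y_F(t)=F^{ -1}((t,\infty))$ and $N_F(t)=F^{ -1}((-\infty,t))$ has at most one bounded connected component.
   Context: Here $F=A_2\circ\sigma\circ A_1$ with $A_1:\mathbb{R}^n\to\mathbb{R}^{n+1}$ and $A_2:\mathbb{R}^{n+1}\to\mathbb{R}$ arbitrary affine maps, and $\sigma$ applying $\mathrm{ReLU}(x)=\max\{0,x\}$ to each coordinate. Write $A_1(x)=Wx+b$. The hyperplane arrangement $\mathcal{A}$ in $\mathbb{R}^n$ associated to the hidden layer consists of the hyperplanes $\{x:W_j\cdot x+b_j=0\}$ for those rows $j$ with $W_j\ne0$. The canonical polyhedral complex $\mathcal{C}(F)$ is the polyhedral decomposition $\mathcal{C}(\mathcal{A})$ of $\mathbb{R}^n$ whose $n$-cells are the closures of the connected components of $\mathbb{R}^n\setminus\bigcup_{H\in\mathcal{A}}H$ and whose lower-dimensional cells are the faces of these; $F$ is affine-linear on each cell. A number $t\in\mathbb{R}$ is a transversal threshold for $F$ if for every cell $C$ of $\mathcal{C}(F)$ of dimension $\ge1$ the restriction of $F$ to the relative interior $\mathrm{int}(C)$ is transverse to $\{t\}$ (its differential is surjective at every point of $\mathrm{int}(C)\cap F^{ -1}(t)$), and $F(v)\ne t$ for every $0$-cell $v$ of $\mathcal{C}(F)$. -}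

module Defs where

open import Level using (0ℓ; suc)
open import Algebra.Bundles using (CommutativeRing)
import Algebra.Construct.NaturalChoice.Max as Max
import Algebra.Properties.Semiring.Sum as Sum
open import Data.Fin.Base using (Fin; zero)
open import Data.Nat.Base as ℕ using (ℕ)
open import Data.Product.Base using (Σ; ∃; _×_)
open import Data.Vec.Functional using (Vector; foldr; map; zipWith)
import Data.Vec.Functional.Relation.Binary.Equality.Setoid as VecEquality
open import Relation.Binary.Bundles using (TotalOrder)
open import Relation.Binary.Core using (Rel)
import Relation.Binary.Construct.NonStrictToStrict as NonStrictToStrict
open import Relation.Binary.Structures using (IsTotalOrder)
open import Relation.Nullary.Negation using (¬_)
open import Relation.Unary
  using (Pred; _∈_; _⊆_; _≐_; _∩_; _∪_; _≬_; Satisfiable)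

-- The axioms of the real number field.  Classically they determine the
-- structure up to unique isomorphism, so quantifying over all such structures
-- is quantifying over presentations of ℝ.  Equality is a setoid equality,
-- which admits presentations such as Cauchy sequences of rationals.
record CompleteOrderedField : Set₁ where
  infix 4 _≤_
  field
    commutativeRing : CommutativeRing 0ℓ 0ℓ

  open CommutativeRing commutativeRing public

  field
    _≤_          : Rel Carrier 0ℓ
    isTotalOrder : IsTotalOrder _≈_ _≤_
    0≉1          : ¬ (0# ≈ 1#)
    inverse      : ∀ x → ¬ (x ≈ 0#) → ∃ λ y → x * y ≈ 1#
    +-monoʳ-≤    : ∀ z {x y} → x ≤ y → z + x ≤ z + y
    *-nonneg     : ∀ {x y} → 0# ≤ x → 0# ≤ y → 0# ≤ x * y

  IsUpperBound : Pred Carrier 0ℓ → Pred Carrier 0ℓ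
  IsUpperBound S u = ∀ {x} → x ∈ S → x ≤ u

  field
    complete : (S : Pred Carrier 0ℓ) → Satisfiable S → Satisfiable (IsUpperBound S) →
               ∃ λ s → IsUpperBound S s × (∀ {u} → IsUpperBound S u → s ≤ u)

  totalOrder : TotalOrder 0ℓ 0ℓ 0ℓ
  totalOrder = record { isTotalOrder = isTotalOrder }

  open NonStrictToStrict _≈_ _≤_ public using (_<_)
  open Max totalOrder public using (_⊔_)

  ∣_∣ : Carrier → Carrier
  ∣ x ∣ = x ⊔ - x

module Euclidean (ℝ : CompleteOrderedField) where

  open CompleteOrderedField ℝ hiding (zero)
  open Sum semiring using (sum; sum-syntax)
  open VecEquality setoid using (_≋_)

  infixl 7 _·_
  infixl 6 _+ᵥ_ _-ᵥ_

  Point : ℕ → Set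
  Point n = Vector Carrier n

  Region : ℕ → Set₁
  Region n = Pred (Point n) 0ℓ

  _+ᵥ_ _-ᵥ_ : ∀ {n} → Point n → Point n → Point n
  _+ᵥ_ = zipWith _+_
  _-ᵥ_ = zipWith _-_

  _·_ : ∀ {n} → Point n → Point n → Carrier
  x · y = sum (zipWith _*_ x y)

  -- The maximum norm.  All norms on ℝⁿ are equivalent, so open sets,
  -- boundedness and differentials do not depend on this choice.
  ‖_‖ : ∀ {n} → Point n → Carrier
  ‖ x ‖ = foldr _⊔_ 0# (map ∣_∣ x)

  IsOpen : ∀ {n} → Region n → Set
  IsOpen U = ∀ x → x ∈ U → ∃ λ ε → 0# < ε × (∀ y → ‖ y -ᵥ x ‖ < ε → y ∈ U)

  Closure : ∀ {n} → Region n → Region n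
  Closure S x = ∀ ε → 0# < ε → ∃ λ y → y ∈ S × ‖ y -ᵥ x ‖ < ε

  IsBounded : ∀ {n} → Region n → Set
  IsBounded S = ∃ λ M → ∀ x → x ∈ S → ‖ x ‖ ≤ M

  IsConnected : ∀ {n} → Region n → Set₁
  IsConnected {n} S = (U V : Region n) → IsOpen U → IsOpen V → S ⊆ U ∪ V →
                      S ≬ U → S ≬ V → ¬ ¬ (S ≬ U ∩ V)

  IsComponent : ∀ {n} → Region n → Region n → Set₁
  IsComponent {n} S C =
    Satisfiable C × C ⊆ S × IsConnected C ×
    ((D : Region n) → IsConnected D → D ⊆ S → C ⊆ D → D ⊆ C)

  AtMostOneBoundedComponent : ∀ {n} → Region n → Set₁
  AtMostOneBoundedComponent {n} S =
    (C D : Region n) → IsComponent S C → IsBounded C →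
    IsComponent S D → IsBounded D → C ≐ D

  combination : ∀ {n k} → Vector Carrier k → Vector (Point n) k → Point n
  combination {k = k} c p i = ∑[ j < k ] (c j * p j i)

  AffineSpan : ∀ {n k} → Vector (Point n) k → Region n
  AffineSpan p x = ∃ λ c → sum c ≈ 1# × combination c p ≋ x

  AffinelyIndependent : ∀ {n k} → Vector (Point n) k → Set
  AffinelyIndependent p =
    ∀ c → sum c ≈ 0# → (∀ i → combination c p i ≈ 0#) → ∀ j → c j ≈ 0#

  AffineHull : ∀ {n} → Region n → Region n
  AffineHull {n} S x =
    Σ ℕ λ k → Σ (Vector (Point n) k) λ p → (∀ j → p j ∈ S) × x ∈ AffineSpan p

  HasDimension : ∀ {n} → Region n → ℕ → Set
  HasDimension {n} S d =
    Σ (Vector (Point n) (ℕ.suc d)) λ p →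
    AffinelyIndependent p × AffineSpan p ≐ AffineHull S

  RelativeInterior : ∀ {n} → Region n → Region n
  RelativeInterior S x =
    x ∈ S × ∃ λ ε → 0# < ε × (∀ y → y ∈ AffineHull S → ‖ y -ᵥ x ‖ < ε → y ∈ S)

  -- G is a face of the polyhedral set P when it is cut out by a linear
  -- inequality valid on P.  Taking u and β to be zero makes P a face of itself.
  IsFace : ∀ {n} → Region n → Region n → Set
  IsFace {n} P G =
    Σ (Point n) λ u → ∃ λ β →
    (∀ x → x ∈ P → u · x ≤ β) × G ≐ P ∩ (λ x → u · x ≈ β)

  -- For x in the relative interior M of C, the tangent space of M at x.
  Tangent : ∀ {n} → Region n → Point n → Region n
  Tangent C x v = (x +ᵥ v) ∈ AffineHull C

  -- The linear functional v ↦ u · v on Tangent C x is the differential at x of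
  -- the restriction of f to the relative interior of C.  Every linear functional
  -- on a subspace of ℝⁿ has this form.
  IsDifferential : ∀ {n} → (Point n → Carrier) → Region n → Point n → Point n → Set
  IsDifferential f C x u =
    ∀ ε → 0# < ε → ∃ λ δ → 0# < δ ×
    (∀ y → y ∈ RelativeInterior C → ‖ y -ᵥ x ‖ < δ →
      ∣ (f y - f x) - u · (y -ᵥ x) ∣ ≤ ε * ‖ y -ᵥ x ‖)

  -- The tangent space of {t} is zero, so transversality at a point of the
  -- preimage is surjectivity of the differential onto ℝ.
  TransverseOnInterior : ∀ {n} → (Point n → Carrier) → Region n → Carrier → Set
  TransverseOnInterior {n} f C t =
    ∀ x → x ∈ RelativeInterior C → f x ≈ t →
    Σ (Point n) λ u → IsDifferential f C x u ×
    (∀ r → ∃ λ v → v ∈ Tangent C x × u · v ≈ r)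

module NeuralNetwork (ℝ : CompleteOrderedField) where

  open CompleteOrderedField ℝ hiding (zero)
  open Euclidean ℝ public

  record AffineMap (n m : ℕ) : Set where
    field
      weight : Fin m → Point n
      bias   : Point m

    apply : Point n → Point m
    apply x j = weight j · x + bias j

  open AffineMap public

  ReLU : Carrier → Carrier
  ReLU x = 0# ⊔ x

  record ReLUNetwork (n m : ℕ) : Set where
    field
      hidden : AffineMap n m
      output : AffineMap m 1

    eval : Point n → Carrier
    eval x = apply output (map ReLU (apply hidden x)) zero

  open ReLUNetwork public

  module _ {n m : ℕ} (F : ReLUNetwork n m) where

    -- Rows with zero weight contribute no hyperplane.
    ArrangementComplement : Region n
    ArrangementComplement x =
      ∀ j → ¬ (∀ i → weight (hidden F) j i ≈ 0#) → ¬ (apply (hidden F) x j ≈ 0#)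

    IsCell : Region n → Set₁
    IsCell C =
      Satisfiable C ×
      Σ (Region n) λ D → IsComponent ArrangementComplement D × IsFace (Closure D) C

    record IsTransversalThreshold (t : Carrier) : Set₁ where
      field
        transverse    : ∀ C → IsCell C → ∀ d → 1 ℕ.≤ d → HasDimension C d →
                        TransverseOnInterior (eval F) C t
        avoids-0-cell : ∀ C → IsCell C → HasDimension C 0 →
                        ∀ v → v ∈ C → ¬ (eval F v ≈ t)

    Y : Carrier → Region n
    Y t x = t < eval F x

    N : Carrier → Region n
    N t x = eval F x < t

{-# OPTIONS --safe #-}

-- Let y = W x + b be the n + 1 preactivations.  There is l ≠ 0 with lᵀ W = 0, so that l · y is
-- the constant l · b, which may be taken nonnegative.  Let Δ be the closed cell on which every yⱼ
-- has the sign of lⱼ.  F is affine on Δ, so Δ meets a decision region S in a convex set, and it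
-- suffices that every bounded component C of S meets Δ.
--
-- Let x ∈ C.  If W has a nontrivial kernel, then C contains a line.  Otherwise the image of W is
-- the hyperplane orthogonal to l.  As l · b ≥ 0, the negative part N of the terms lⱼ yⱼ is at most
-- their positive part P, so ρ P = N with 0 ≤ ρ ≤ 1, and there is v such that W v is y on the
-- coordinates with the wrong sign and ρ y on the others.  Then x - v lies in Δ, and all x + s v
-- with s ≥ -1 lie in one closed cell, on which F is affine.  Either x - v ∈ S, and then x - v ∈ C,
-- or F moves away from the threshold along v and the unbounded ray x + s v, s ≥ 0, lies in C.
module Submission where

open import Defs
open import Level using (0ℓ; Lift; lift; lower) renaming (suc to lsuc)
open import Algebra.Solver.Ring.AlmostCommutativeRing
  using (fromCommutativeRing; Induced-equivalence; _-Raw-AlmostCommutative⟶_)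
import Algebra.Properties.Ring as RingProperties
import Algebra.Properties.Semiring.Mult.TCOptimised as Mult
import Algebra.Properties.Semiring.Sum as Sum
import Algebra.Construct.NaturalChoice.Max as Max
import Algebra.Solver.Ring as RingSolver
open import Axiom.ExcludedMiddle using (ExcludedMiddle)
open import Data.Empty using (⊥)
open import Data.Fin.Base using (Fin; zero; suc; punchIn)
import Data.Fin.Properties as Fin
open import Data.Integer.Base as ℤ using (ℤ; +_; -[1+_])
import Data.Integer.Properties as ℤ
open import Data.Maybe.Base using (just; nothing)
open import Data.Nat.Base as ℕ using (ℕ; suc; zero; _≤_)
import Data.Nat.Properties as ℕ
open import Data.Product.Base using (∃; _×_; _,_; proj₁; proj₂)
open import Data.Sum.Base using (_⊎_; inj₁; inj₂)
open import Data.Vec.Functional using (_∷_; tail; insertAt; removeAt)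
open import Data.Vec.Functional.Properties using (insertAt-lookup; insertAt-punchIn)
open import Function.Base using (_∘_)
import Relation.Binary.Construct.NonStrictToStrict as NonStrictToStrict
open import Relation.Binary.Definitions using (_Respects_; WeaklyDecidable)
open import Relation.Binary.PropositionalEquality as ≡ using (_≡_)
import Relation.Binary.Reasoning.Setoid as SetoidReasoning
open import Relation.Binary.Structures using (IsTotalOrder)
open import Relation.Nullary.Decidable using (Dec; yes; no; map′; decidable-stable)
open import Relation.Nullary.Negation using (¬_; contradiction)
open import Relation.Unary using (Pred; _∈_; _⊆_; _≐_; _∩_; _∪_)

-- Arithmetic and order of the field.

module OrderedField (ℝ : CompleteOrderedField) where

  open CompleteOrderedField ℝ hiding (zero; _≤_; +-monoʳ-≤)
  open CompleteOrderedField ℝ public using () renaming (_≤_ to infix 4 _≤ᵣ_; +-monoʳ-≤ to +-monoʳ-≤ᵣ)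
  open IsTotalOrder isTotalOrder public using (total; antisym)
    renaming (refl to ≤-refl; trans to ≤-trans; reflexive to ≤-reflexive)
  open Mult semiring using (×-homo-+; ×1-homo-*; 1+×) renaming (_×_ to _×ᵣ_)
  open RingProperties ring using (-‿distribˡ-*; -‿distribʳ-*; -‿+-comm; -‿involutive; -0#≈0#)

  private
    ⟦_⟧ : ℤ → Carrier
    ⟦ + n ⟧      = n ×ᵣ 1#
    ⟦ -[1+ n ] ⟧ = - (suc n ×ᵣ 1#)

    ⟦⟧-⊖ : ∀ m n → ⟦ m ℤ.⊖ n ⟧ ≈ m ×ᵣ 1# + - (n ×ᵣ 1#)
    ⟦⟧-⊖ m       zero    = sym (trans (+-congˡ -0#≈0#) (+-identityʳ _))
    ⟦⟧-⊖ zero    (suc n) = sym (+-identityˡ _)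
    ⟦⟧-⊖ (suc m) (suc n) = begin
      ⟦ suc m ℤ.⊖ suc n ⟧            ≡⟨ ≡.cong ⟦_⟧ (ℤ.[1+m]⊖[1+n]≡m⊖n m n) ⟩
      ⟦ m ℤ.⊖ n ⟧                    ≈⟨ ⟦⟧-⊖ m n ⟩
      a + - b                        ≈⟨ +-congʳ (sym (+-identityˡ a)) ⟩
      0# + a + - b                   ≈⟨ +-congʳ (+-congʳ (sym (-‿inverseʳ 1#))) ⟩
      1# + - 1# + a + - b            ≈⟨ +-congʳ (+-assoc 1# (- 1#) a) ⟩
      1# + (- 1# + a) + - b          ≈⟨ +-congʳ (+-congˡ (+-comm (- 1#) a)) ⟩
      1# + (a + - 1#) + - b          ≈⟨ +-congʳ (sym (+-assoc 1# a (- 1#))) ⟩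
      1# + a + - 1# + - b            ≈⟨ +-assoc (1# + a) (- 1#) (- b) ⟩
      1# + a + (- 1# + - b)          ≈⟨ +-congˡ (-‿+-comm 1# b) ⟩
      1# + a + - (1# + b)            ≈⟨ sym (+-cong (1+× m 1#) (-‿cong (1+× n 1#))) ⟩
      suc m ×ᵣ 1# + - (suc n ×ᵣ 1#)  ∎
      where
      open SetoidReasoning setoid
      a = m ×ᵣ 1#
      b = n ×ᵣ 1#

    ⟦⟧-neg : ∀ i → ⟦ ℤ.- i ⟧ ≈ - ⟦ i ⟧
    ⟦⟧-neg (+ zero)   = sym -0#≈0#
    ⟦⟧-neg (+ suc n)  = refl
    ⟦⟧-neg (-[1+ n ]) = sym (-‿involutive _)

    ⟦⟧-+ : ∀ i j → ⟦ i ℤ.+ j ⟧ ≈ ⟦ i ⟧ + ⟦ j ⟧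
    ⟦⟧-+ (+ m)      (+ n)      = ×-homo-+ 1# m n
    ⟦⟧-+ (+ m)      (-[1+ n ]) = ⟦⟧-⊖ m (suc n)
    ⟦⟧-+ (-[1+ m ]) (+ n)      = trans (⟦⟧-⊖ n (suc m)) (+-comm _ _)
    ⟦⟧-+ (-[1+ m ]) (-[1+ n ]) = begin
      - (suc (suc (m ℕ.+ n)) ×ᵣ 1#)       ≡⟨ ≡.cong (λ k → - (suc k ×ᵣ 1#)) (≡.sym (ℕ.+-suc m n)) ⟩
      - ((suc m ℕ.+ suc n) ×ᵣ 1#)         ≈⟨ -‿cong (×-homo-+ 1# (suc m) (suc n)) ⟩
      - (suc m ×ᵣ 1# + suc n ×ᵣ 1#)       ≈⟨ sym (-‿+-comm _ _) ⟩
      - (suc m ×ᵣ 1#) + - (suc n ×ᵣ 1#)   ∎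
      where
      open SetoidReasoning setoid

    ⟦⟧-*-nonneg : ∀ m j → ⟦ + m ℤ.* j ⟧ ≈ ⟦ + m ⟧ * ⟦ j ⟧
    ⟦⟧-*-nonneg m (+ n) =
      trans (reflexive (≡.cong ⟦_⟧ (≡.sym (ℤ.pos-* m n)))) (×1-homo-* m n)
    ⟦⟧-*-nonneg m -[1+ n ] = begin
      ⟦ + m ℤ.* ℤ.- (+ suc n) ⟧    ≡⟨ ≡.cong ⟦_⟧ (≡.sym (ℤ.neg-distribʳ-* (+ m) (+ suc n))) ⟩
      ⟦ ℤ.- (+ m ℤ.* + suc n) ⟧    ≈⟨ ⟦⟧-neg (+ m ℤ.* + suc n) ⟩
      - ⟦ + m ℤ.* + suc n ⟧        ≈⟨ -‿cong (⟦⟧-*-nonneg m (+ suc n)) ⟩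
      - (⟦ + m ⟧ * ⟦ + suc n ⟧)    ≈⟨ -‿distribʳ-* _ _ ⟩
      ⟦ + m ⟧ * - ⟦ + suc n ⟧      ∎
      where open SetoidReasoning setoid

    ⟦⟧-* : ∀ i j → ⟦ i ℤ.* j ⟧ ≈ ⟦ i ⟧ * ⟦ j ⟧
    ⟦⟧-* (+ m)    j = ⟦⟧-*-nonneg m j
    ⟦⟧-* -[1+ m ] j = begin
      ⟦ ℤ.- (+ suc m) ℤ.* j ⟧      ≡⟨ ≡.cong ⟦_⟧ (≡.sym (ℤ.neg-distribˡ-* (+ suc m) j)) ⟩
      ⟦ ℤ.- (+ suc m ℤ.* j) ⟧      ≈⟨ ⟦⟧-neg (+ suc m ℤ.* j) ⟩
      - ⟦ + suc m ℤ.* j ⟧          ≈⟨ -‿cong (⟦⟧-*-nonneg (suc m) j) ⟩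
      - (⟦ + suc m ⟧ * ⟦ j ⟧)      ≈⟨ -‿distribˡ-* _ _ ⟩
      - ⟦ + suc m ⟧ * ⟦ j ⟧        ∎
      where open SetoidReasoning setoid

    -- Integer coefficients let the ring solver compare and cancel constants by computation.
    ℤ⟶ℝ : ℤ.+-*-rawRing -Raw-AlmostCommutative⟶ fromCommutativeRing commutativeRing
    ℤ⟶ℝ = record
      { ⟦_⟧    = ⟦_⟧
      ; +-homo = ⟦⟧-+
      ; *-homo = ⟦⟧-*
      ; -‿homo = ⟦⟧-neg
      ; 0-homo = refl
      ; 1-homo = refl
      }

    _coeff≟_ : WeaklyDecidable (Induced-equivalence ℤ⟶ℝ)
    i coeff≟ j with i ℤ.≟ j
    ... | yes ≡.refl = just (refl {⟦ i ⟧})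
    ... | no  _      = nothing

  open RingSolver ℤ.+-*-rawRing (fromCommutativeRing commutativeRing) ℤ⟶ℝ _coeff≟_ public
    using (Polynomial; solve; con; _:+_; _:*_; _:-_; :-_; _:=_)

  :0 :1 : ∀ {n} → Polynomial n
  :0 = con (+ 0)
  :1 = con (+ 1)

  ≤-resp : ∀ {x x′ y y′} → x ≈ x′ → y ≈ y′ → x ≤ᵣ y → x′ ≤ᵣ y′
  ≤-resp p q x≤y = ≤-trans (≤-reflexive (sym p)) (≤-trans x≤y (≤-reflexive q))

  ≤-respʳ : ∀ {x y y′} → y ≈ y′ → x ≤ᵣ y → x ≤ᵣ y′
  ≤-respʳ = ≤-resp refl

  -- Splits an inequality into a nonnegative expression, built from the hypotheses, and an identity
  -- left to the ring solver.
  ≤-by : ∀ {x y d} → 0# ≤ᵣ d → y - x ≈ d → x ≤ᵣ y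
  ≤-by {x} {y} {d} 0≤d y-x≈d =
    ≤-resp (+-identityʳ x)
      (trans (+-congˡ (sym y-x≈d)) (solve 2 (λ x y → x :+ (y :- x) := y) refl x y))
      (+-monoʳ-≤ᵣ x 0≤d)

  ≤⇒0≤- : ∀ {x y} → x ≤ᵣ y → 0# ≤ᵣ y - x
  ≤⇒0≤- {x} {y} x≤y =
    ≤-resp (-‿inverseˡ x) (+-comm (- x) y) (+-monoʳ-≤ᵣ (- x) x≤y)

  +-mono-≤ : ∀ {w x y z} → w ≤ᵣ x → y ≤ᵣ z → w + y ≤ᵣ x + z
  +-mono-≤ {w} {x} {y} {z} w≤x y≤z =
    ≤-trans (+-monoʳ-≤ᵣ w y≤z) (≤-resp (+-comm z w) (+-comm z x) (+-monoʳ-≤ᵣ z w≤x))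

  +-nonneg : ∀ {x y} → 0# ≤ᵣ x → 0# ≤ᵣ y → 0# ≤ᵣ x + y
  +-nonneg 0≤x 0≤y = ≤-resp (+-identityˡ 0#) refl (+-mono-≤ 0≤x 0≤y)

  x≤0⇒0≤-x : ∀ {x} → x ≤ᵣ 0# → 0# ≤ᵣ - x
  x≤0⇒0≤-x x≤0 = ≤-respʳ (+-identityˡ _) (≤⇒0≤- x≤0)

  -- If `1# ≤ᵣ 0#`, then `- 1#` is nonnegative, and so is its square `1#`.
  0≤1 : 0# ≤ᵣ 1#
  0≤1 with total 0# 1#
  ... | inj₁ 0≤1 = 0≤1
  ... | inj₂ 1≤0 =
    ≤-respʳ (solve 0 ((:- :1) :* (:- :1) := :1) refl)
      (*-nonneg (x≤0⇒0≤-x 1≤0) (x≤0⇒0≤-x 1≤0))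

  1≰0 : ¬ (1# ≤ᵣ 0#)
  1≰0 1≤0 = 0≉1 (antisym 0≤1 1≤0)

  *-monoʳ-≤ : ∀ {a x y} → 0# ≤ᵣ a → x ≤ᵣ y → a * x ≤ᵣ a * y
  *-monoʳ-≤ {a} {x} {y} 0≤a x≤y =
    ≤-by (*-nonneg 0≤a (≤⇒0≤- x≤y))
      (solve 3 (λ a x y → a :* y :- a :* x := a :* (y :- x)) refl a x y)

  *-monoˡ-≤ : ∀ {a x y} → 0# ≤ᵣ a → x ≤ᵣ y → x * a ≤ᵣ y * a
  *-monoˡ-≤ {a} {x} {y} 0≤a x≤y = ≤-resp (*-comm a x) (*-comm a y) (*-monoʳ-≤ 0≤a x≤y)

  inverse-nonneg : ∀ {x k} → 0# ≤ᵣ x → x * k ≈ 1# → 0# ≤ᵣ k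
  inverse-nonneg {x} {k} 0≤x xk≈1 with total 0# k
  ... | inj₁ 0≤k = 0≤k
  ... | inj₂ k≤0 = contradiction (≤-resp xk≈1 (zeroʳ x) (*-monoʳ-≤ 0≤x k≤0)) 1≰0

  *-cancelˡ-≈0 : ∀ {a x} → ¬ a ≈ 0# → a * x ≈ 0# → x ≈ 0#
  *-cancelˡ-≈0 {a} {x} a≉0 ax≈0 = begin
    x              ≈⟨ sym (*-identityˡ x) ⟩
    1# * x         ≈⟨ *-congʳ (sym ak≈1) ⟩
    a * k * x      ≈⟨ solve 3 (λ a k x → a :* k :* x := k :* (a :* x)) refl a k x ⟩
    k * (a * x)    ≈⟨ *-congˡ ax≈0 ⟩
    k * 0#         ≈⟨ zeroʳ k ⟩
    0#             ∎
    where
    open SetoidReasoning setoid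
    k = proj₁ (inverse a a≉0)
    ak≈1 = proj₂ (inverse a a≉0)

  <⇒≰ : ∀ {x y} → x < y → ¬ y ≤ᵣ x
  <⇒≰ = NonStrictToStrict.<⇒≱ _≈_ _≤ᵣ_ antisym

  ≰⇒> : ∀ {x y} → ¬ x ≤ᵣ y → y < x
  ≰⇒> = NonStrictToStrict.≰⇒> _≈_ _≤ᵣ_ sym ≤-reflexive total

  <-≤-trans : ∀ {x y z} → x < y → y ≤ᵣ z → x < z
  <-≤-trans = NonStrictToStrict.<-≤-trans _≈_ _≤ᵣ_ sym ≤-trans antisym ≤-respʳ

  ≤-<-trans : ∀ {x y z} → x ≤ᵣ y → y < z → x < z
  ≤-<-trans = NonStrictToStrict.≤-<-trans _≈_ _≤ᵣ_ ≤-trans antisym (λ p → ≤-resp p refl)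

  <-resp : ∀ {x x′ y y′} → x ≈ x′ → y ≈ y′ → x < y → x′ < y′
  <-resp p q x<y = ≤-<-trans (≤-reflexive (sym p)) (<-≤-trans x<y (≤-reflexive q))

  *-pos : ∀ {x y} → 0# < x → 0# < y → 0# < x * y
  *-pos (0≤x , 0≉x) (0≤y , 0≉y) =
    *-nonneg 0≤x 0≤y , λ 0≈xy → 0≉y (sym (*-cancelˡ-≈0 (0≉x ∘ sym) (sym 0≈xy)))

  inverse-pos : ∀ {x k} → 0# ≤ᵣ x → x * k ≈ 1# → 0# < k
  inverse-pos {x} 0≤x xk≈1 =
    inverse-nonneg 0≤x xk≈1 , λ 0≈k → 0≉1 (trans (sym (zeroʳ x)) (trans (*-congˡ 0≈k) xk≈1))

  1+nonneg≉0 : ∀ {x} → 0# ≤ᵣ x → ¬ 1# + x ≈ 0#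
  1+nonneg≉0 0≤x 1+x≈0 = 1≰0 (≤-resp (+-identityʳ 1#) 1+x≈0 (+-monoʳ-≤ᵣ 1# 0≤x))

  ratio : ∀ {x y} → Dec (y ≈ 0#) → 0# ≤ᵣ x → x ≤ᵣ y → ∃ λ ρ → 0# ≤ᵣ ρ × ρ ≤ᵣ 1# × ρ * y ≈ x
  -- Here `x` is squeezed to zero as well, so the default factor `0#` works.
  ratio (yes y≈0) 0≤x x≤y =
    0# , ≤-refl , 0≤1 , trans (zeroˡ _) (antisym 0≤x (≤-respʳ y≈0 x≤y))
  ratio {x} {y} (no y≉0) 0≤x x≤y =
    x * k , *-nonneg 0≤x 0≤k , ≤-respʳ yk≈1 (*-monoˡ-≤ 0≤k x≤y) ,
    trans (solve 3 (λ x y k → x :* k :* y := x :* (y :* k)) refl x y k)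
      (trans (*-congˡ yk≈1) (*-identityʳ x))
    where
    k = proj₁ (inverse y y≉0)
    yk≈1 = proj₂ (inverse y y≉0)
    0≤k = inverse-nonneg (≤-trans 0≤x x≤y) yk≈1

  -- The number `θ` is the parameter at which `x` divides the segment from `x - v` to `x + s v`. It
  -- is at most one because `1 - θ` equals `s * θ`.
  inverse-1+ : ∀ {s} → 0# ≤ᵣ s → ∃ λ θ → 0# ≤ᵣ θ × θ ≤ᵣ 1# × (1# + s) * θ ≈ 1#
  inverse-1+ {s} 0≤s = θ , 0≤θ , θ≤1 , [1+s]θ≈1
    where
    θ = proj₁ (inverse (1# + s) (1+nonneg≉0 0≤s))
    [1+s]θ≈1 = proj₂ (inverse (1# + s) (1+nonneg≉0 0≤s))
    0≤θ = inverse-nonneg (+-nonneg 0≤1 0≤s) [1+s]θ≈1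
    θ≤1 = ≤-by (*-nonneg 0≤s 0≤θ) (trans (+-congʳ (sym [1+s]θ≈1))
      (solve 2 (λ s θ → (:1 :+ s) :* θ :- θ := s :* θ) refl s θ))

  -- Interpolation, convex sets of scalars and half-lines.

  lerp : Carrier → Carrier → Carrier → Carrier
  lerp a b s = a + s * (b - a)

  lerp-cong : ∀ {a a′ b b′ s} → a ≈ a′ → b ≈ b′ → lerp a b s ≈ lerp a′ b′ s
  lerp-cong p q = +-cong p (*-congˡ (+-cong q (-‿cong p)))

  lerp-lower : ∀ {m a b s} → m ≤ᵣ a → m ≤ᵣ b → 0# ≤ᵣ s → s ≤ᵣ 1# → m ≤ᵣ lerp a b s
  lerp-lower {m} {a} {b} {s} m≤a m≤b 0≤s s≤1 =
    ≤-by (+-nonneg (*-nonneg (≤⇒0≤- s≤1) (≤⇒0≤- m≤a)) (*-nonneg 0≤s (≤⇒0≤- m≤b)))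
      (solve 4 (λ m a b s →
        (a :+ s :* (b :- a)) :- m := (:1 :- s) :* (a :- m) :+ s :* (b :- m)) refl m a b s)

  lerp-upper : ∀ {m a b s} → a ≤ᵣ m → b ≤ᵣ m → 0# ≤ᵣ s → s ≤ᵣ 1# → lerp a b s ≤ᵣ m
  lerp-upper {m} {a} {b} {s} a≤m b≤m 0≤s s≤1 =
    ≤-by (+-nonneg (*-nonneg (≤⇒0≤- s≤1) (≤⇒0≤- a≤m)) (*-nonneg 0≤s (≤⇒0≤- b≤m)))
      (solve 4 (λ m a b s →
        m :- (a :+ s :* (b :- a)) := (:1 :- s) :* (m :- a) :+ s :* (m :- b)) refl m a b s)

  IsConvexSet : Pred Carrier 0ℓ → Set
  IsConvexSet H = ∀ {a b s} → a ∈ H → b ∈ H → 0# ≤ᵣ s → s ≤ᵣ 1# → lerp a b s ∈ H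

  -- The smaller endpoint bounds the interpolated value from below and itself exceeds `t`, so
  -- strictness is kept.
  >-convex : ∀ {t} → IsConvexSet (t <_)
  >-convex {t} {a} {b} t<a t<b 0≤s s≤1 with total a b
  ... | inj₁ a≤b = <-≤-trans t<a (lerp-lower ≤-refl a≤b 0≤s s≤1)
  ... | inj₂ b≤a = <-≤-trans t<b (lerp-lower b≤a ≤-refl 0≤s s≤1)

  <-convex : ∀ {t} → IsConvexSet (_< t)
  <-convex {t} {a} {b} a<t b<t 0≤s s≤1 with total a b
  ... | inj₁ a≤b = ≤-<-trans (lerp-upper a≤b ≤-refl 0≤s s≤1) b<t
  ... | inj₂ b≤a = ≤-<-trans (lerp-upper ≤-refl b≤a 0≤s s≤1) a<t

  -- Both half-lines contain zero, so a point on a hyperplane lies in the closed cells on both of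
  -- its sides.
  data Side : Set where
    nonnegative nonpositive : Side

  HalfLine : Side → Pred Carrier 0ℓ
  HalfLine nonnegative a = 0# ≤ᵣ a
  HalfLine nonpositive a = a ≤ᵣ 0#

  side : ∀ a → ∃ λ τ → a ∈ HalfLine τ
  side a with total 0# a
  ... | inj₁ 0≤a = nonnegative , 0≤a
  ... | inj₂ a≤0 = nonpositive , a≤0

  HalfLine-resp : ∀ τ → HalfLine τ Respects _≈_
  HalfLine-resp nonnegative p = ≤-resp refl p
  HalfLine-resp nonpositive p = ≤-resp p refl

  0∈HalfLine : ∀ τ → 0# ∈ HalfLine τ
  0∈HalfLine nonnegative = ≤-refl
  0∈HalfLine nonpositive = ≤-refl

  HalfLine-scale : ∀ τ {c a} → 0# ≤ᵣ c → a ∈ HalfLine τ → c * a ∈ HalfLine τ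
  HalfLine-scale nonnegative 0≤c 0≤a = *-nonneg 0≤c 0≤a
  HalfLine-scale nonpositive {c} 0≤c a≤0 = ≤-respʳ (zeroʳ c) (*-monoʳ-≤ 0≤c a≤0)

  HalfLine-* : ∀ τ {a b} → a ∈ HalfLine τ → b ∈ HalfLine τ → 0# ≤ᵣ a * b
  HalfLine-* nonnegative = *-nonneg
  HalfLine-* nonpositive {a} {b} a≤0 b≤0 =
    ≤-respʳ (solve 2 (λ a b → (:- a) :* (:- b) := a :* b) refl a b)
      (*-nonneg (x≤0⇒0≤-x a≤0) (x≤0⇒0≤-x b≤0))

  HalfLine-*-∉ : ∀ τ {a b} → a ∈ HalfLine τ → ¬ b ∈ HalfLine τ → a * b ≤ᵣ 0#
  HalfLine-*-∉ nonnegative {a} 0≤a 0≰b = ≤-respʳ (zeroʳ a) (*-monoʳ-≤ 0≤a (proj₁ (≰⇒> 0≰b)))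
  HalfLine-*-∉ nonpositive {a} {b} a≤0 b≰0 =
    ≤-resp (*-comm b a) (zeroʳ b) (*-monoʳ-≤ (proj₁ (≰⇒> b≰0)) a≤0)

  HalfLine-convex : ∀ τ → IsConvexSet (HalfLine τ)
  HalfLine-convex nonnegative = lerp-lower
  HalfLine-convex nonpositive = lerp-upper

  open Max totalOrder public using (x≤y⇒x⊔y≈y; x≤y⇒y⊔x≈y; ⊔-lub; x≤x⊔y; ⊔-congˡ)
    renaming (x≤y⊔x to y≤x⊔y)

  -- ReLU is the identity on one half-line and zero on the other, and interpolation does not leave a
  -- half-line.
  ReLU-lerp : ∀ τ {a b s} → a ∈ HalfLine τ → b ∈ HalfLine τ → 0# ≤ᵣ s → s ≤ᵣ 1# →
              0# ⊔ lerp a b s ≈ lerp (0# ⊔ a) (0# ⊔ b) s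
  ReLU-lerp nonnegative 0≤a 0≤b 0≤s s≤1 =
    trans (x≤y⇒x⊔y≈y (lerp-lower 0≤a 0≤b 0≤s s≤1))
      (lerp-cong (sym (x≤y⇒x⊔y≈y 0≤a)) (sym (x≤y⇒x⊔y≈y 0≤b)))
  ReLU-lerp nonpositive {s = s} a≤0 b≤0 0≤s s≤1 =
    trans (x≤y⇒y⊔x≈y (lerp-upper a≤0 b≤0 0≤s s≤1))
      (trans (solve 1 (λ s → :0 := :0 :+ s :* (:0 :- :0)) refl s)
        (lerp-cong (sym (x≤y⇒y⊔x≈y a≤0)) (sym (x≤y⇒y⊔x≈y b≤0))))

-- The maximum norm, open sets and segments.

module Topology (ℝ : CompleteOrderedField) where

  open CompleteOrderedField ℝ hiding (zero; _≤_; +-monoʳ-≤)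
  open OrderedField ℝ
  open Euclidean ℝ

  ∣∣-nonneg : ∀ x → 0# ≤ᵣ ∣ x ∣
  ∣∣-nonneg x with total 0# x
  ... | inj₁ 0≤x = ≤-trans 0≤x (x≤x⊔y x (- x))
  ... | inj₂ x≤0 = ≤-trans (x≤0⇒0≤-x x≤0) (y≤x⊔y x (- x))

  ∣∣-* : ∀ {a b c d} → ∣ a ∣ ≤ᵣ c → ∣ b ∣ ≤ᵣ d → ∣ a * b ∣ ≤ᵣ c * d
  ∣∣-* {a} {b} {c} {d} ∣a∣≤c ∣b∣≤d with total 0# a
  ... | inj₁ 0≤a = ⊔-lub
    (bound (≤-trans (x≤x⊔y b (- b)) ∣b∣≤d))
    (≤-resp (solve 2 (λ a b → a :* :- b := :- (a :* b)) refl a b) refl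
      (bound (≤-trans (y≤x⊔y b (- b)) ∣b∣≤d)))
    where
    bound : ∀ {e} → e ≤ᵣ d → a * e ≤ᵣ c * d
    bound e≤d = ≤-trans (*-monoʳ-≤ 0≤a e≤d)
      (*-monoˡ-≤ (≤-trans (∣∣-nonneg b) ∣b∣≤d) (≤-trans (x≤x⊔y a (- a)) ∣a∣≤c))
  ... | inj₂ a≤0 = ⊔-lub
    (≤-resp (solve 2 (λ a b → (:- a) :* :- b := a :* b) refl a b) refl
      (bound (≤-trans (y≤x⊔y b (- b)) ∣b∣≤d)))
    (≤-resp (solve 2 (λ a b → (:- a) :* b := :- (a :* b)) refl a b) refl
      (bound (≤-trans (x≤x⊔y b (- b)) ∣b∣≤d)))
    where
    bound : ∀ {e} → e ≤ᵣ d → - a * e ≤ᵣ c * d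
    bound e≤d = ≤-trans (*-monoʳ-≤ (x≤0⇒0≤-x a≤0) e≤d)
      (*-monoˡ-≤ (≤-trans (∣∣-nonneg b) ∣b∣≤d) (≤-trans (y≤x⊔y a (- a)) ∣a∣≤c))

  ∣∣-cong-≤ : ∀ {x y r} → x ≈ y → ∣ x ∣ ≤ᵣ r → ∣ y ∣ ≤ᵣ r
  ∣∣-cong-≤ {x} p ∣x∣≤r =
    ⊔-lub (≤-resp p refl (≤-trans (x≤x⊔y x (- x)) ∣x∣≤r))
          (≤-resp (-‿cong p) refl (≤-trans (y≤x⊔y x (- x)) ∣x∣≤r))

  ∣∣≤‖‖ : ∀ {n} (x : Point n) i → ∣ x i ∣ ≤ᵣ ‖ x ‖
  ∣∣≤‖‖ x zero    = x≤x⊔y _ _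
  ∣∣≤‖‖ x (suc i) = ≤-trans (∣∣≤‖‖ (tail x) i) (y≤x⊔y _ _)

  ‖‖-nonneg : ∀ {n} (x : Point n) → 0# ≤ᵣ ‖ x ‖
  ‖‖-nonneg {zero}  x = ≤-refl
  ‖‖-nonneg {suc n} x = ≤-trans (‖‖-nonneg (tail x)) (y≤x⊔y _ _)

  ‖‖-lub : ∀ {n r} (x : Point n) → 0# ≤ᵣ r → (∀ i → ∣ x i ∣ ≤ᵣ r) → ‖ x ‖ ≤ᵣ r
  ‖‖-lub {zero}  x 0≤r ∣x∣≤r = 0≤r
  ‖‖-lub {suc n} x 0≤r ∣x∣≤r = ⊔-lub (∣x∣≤r zero) (‖‖-lub (tail x) 0≤r (∣x∣≤r ∘ suc))

  -- A region is an arbitrary predicate and may separate equal points. An open one cannot, since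
  -- equal points are at distance zero.
  IsOpen-resp : ∀ {n} {U : Region n} {x y} → IsOpen U → x ∈ U → (∀ i → y i ≈ x i) → y ∈ U
  IsOpen-resp {x = x} {y} open-U x∈U y≋x with open-U x x∈U
  ... | ε , 0<ε , ball = ball y (≤-<-trans (‖‖-lub (y -ᵥ x) ≤-refl
    (λ i → ∣∣-cong-≤ (sym (trans (+-congʳ (y≋x i)) (-‿inverseʳ (x i))))
      (⊔-lub ≤-refl (≤-reflexive (solve 0 (:- :0 := :0) refl))))) 0<ε)

  segment : ∀ {n} → Point n → Point n → Carrier → Point n
  segment p q s i = lerp (p i) (q i) s

  IsConvex : ∀ {n} → Region n → Set
  IsConvex {n} K = ∀ (p q : Point n) {s} → p ∈ K → q ∈ K → 0# ≤ᵣ s → s ≤ᵣ 1# → segment p q s ∈ K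

  -- A parameter change of at most `δ` moves the point by at most `δ * L`, where `L` is the norm of
  -- `q -ᵥ p`. With `δ = ε / (1 + L)` this is below `ε`, and the denominator is invertible even if
  -- `L` vanishes.
  segment-open : ∀ {n} {U : Region n} → IsOpen U → ∀ p q {s} → segment p q s ∈ U →
                 ∃ λ δ → 0# < δ × (∀ {s′} → s′ - s ≤ᵣ δ → s - s′ ≤ᵣ δ → segment p q s′ ∈ U)
  segment-open open-U p q {s} ps∈U with open-U _ ps∈U
  ... | ε , 0<ε , ball = ε * k , *-pos 0<ε 0<k , λ {s′} s′-s≤δ s-s′≤δ →
    ball _ (≤-<-trans
      (‖‖-lub _ (*-nonneg (proj₁ (*-pos 0<ε 0<k)) (‖‖-nonneg (q -ᵥ p))) λ i →
        ∣∣-cong-≤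
          (solve 4 (λ a b s s′ → (s′ :- s) :* (b :- a) :=
            (a :+ s′ :* (b :- a)) :- (a :+ s :* (b :- a))) refl (p i) (q i) s s′)
          (∣∣-* (⊔-lub s′-s≤δ (≤-resp (solve 2 (λ s s′ → s :- s′ := :- (s′ :- s)) refl s s′) refl s-s′≤δ))
                (∣∣≤‖‖ (q -ᵥ p) i)))
      δL<ε)
    where
    L = ‖ q -ᵥ p ‖
    k = proj₁ (inverse (1# + L) (1+nonneg≉0 (‖‖-nonneg (q -ᵥ p))))
    [1+L]k≈1 = proj₂ (inverse (1# + L) (1+nonneg≉0 (‖‖-nonneg (q -ᵥ p))))
    0<k = inverse-pos (+-nonneg 0≤1 (‖‖-nonneg (q -ᵥ p))) [1+L]k≈1
    ε-δL≈δ : ε - ε * k * L ≈ ε * k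
    ε-δL≈δ = begin
      ε - ε * k * L                   ≈⟨ +-congʳ (sym (*-identityʳ ε)) ⟩
      ε * 1# - ε * k * L              ≈⟨ +-congʳ (*-congˡ (sym [1+L]k≈1)) ⟩
      ε * ((1# + L) * k) - ε * k * L ≈⟨ solve 3 (λ ε k L →
        ε :* ((:1 :+ L) :* k) :- ε :* k :* L := ε :* k) refl ε k L ⟩
      ε * k                           ∎
      where open SetoidReasoning setoid
    δL<ε : ε * k * L < ε
    δL<ε = ≰⇒> λ ε≤δL → <⇒≰ (*-pos 0<ε 0<k)
      (≤-resp ε-δL≈δ (-‿inverseʳ _) (+-mono-≤ ε≤δL ≤-refl))

  -- If `U` and `V` had no common point on the segment, the supremum `σ` of the parameters in `U`
  -- could lie in neither set, because each contains a neighbourhood of each of its parameters.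
  segment-connected : ∀ {n} {U V : Region n} → IsOpen U → IsOpen V → ∀ p q → p ∈ U → q ∈ V →
                      (∀ {s} → 0# ≤ᵣ s → s ≤ᵣ 1# → segment p q s ∈ U ∪ V) →
                      ¬ ¬ ∃ λ s → 0# ≤ᵣ s × s ≤ᵣ 1# × segment p q s ∈ U ∩ V
  segment-connected {U = U} {V} open-U open-V p q p∈U q∈V cover disjoint =
    at-supremum (complete A (0# , ≤-refl , 0≤1 , p₀∈U) (1# , λ (_ , s≤1 , _) → s≤1))
    where
    A : Pred Carrier 0ℓ
    A s = 0# ≤ᵣ s × s ≤ᵣ 1# × segment p q s ∈ U
    p₀∈U : segment p q 0# ∈ U
    p₀∈U = IsOpen-resp open-U p∈U
      (λ i → solve 2 (λ a b → a :+ :0 :* (b :- a) := a) refl (p i) (q i))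
    p₁∈V : segment p q 1# ∈ V
    p₁∈V = IsOpen-resp open-V q∈V
      (λ i → solve 2 (λ a b → a :+ :1 :* (b :- a) := b) refl (p i) (q i))
    at-supremum : ¬ ∃ λ σ → IsUpperBound A σ × (∀ {u} → IsUpperBound A u → σ ≤ᵣ u)
    at-supremum (σ , upper , least) = case (cover 0≤σ σ≤1)
      where
      0≤σ : 0# ≤ᵣ σ
      0≤σ = upper (≤-refl , 0≤1 , p₀∈U)
      σ≤1 : σ ≤ᵣ 1#
      σ≤1 = least λ (_ , s≤1 , _) → s≤1
      Near : Region _ → Set
      Near W = ∃ λ δ → 0# < δ × (∀ {s} → s - σ ≤ᵣ δ → σ - s ≤ᵣ δ → segment p q s ∈ W)
      near-U : ¬ Near U
      -- Either the neighbourhood reaches the endpoint `q`, which then lies in both sets, or `σ + δ`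
      -- is a parameter in `U` beyond the supremum.
      near-U (δ , 0<δ , near) with total 1# (σ + δ)
      ... | inj₁ 1≤σ+δ = disjoint (1# , 0≤1 , ≤-refl , near 1-σ≤δ σ-1≤δ , p₁∈V)
        where
        1-σ≤δ : 1# - σ ≤ᵣ δ
        1-σ≤δ = ≤-by (≤⇒0≤- 1≤σ+δ) (solve 2 (λ σ δ → δ :- (:1 :- σ) := (σ :+ δ) :- :1) refl σ δ)
        σ-1≤δ : σ - 1# ≤ᵣ δ
        σ-1≤δ = ≤-trans (≤-by (≤⇒0≤- σ≤1) (solve 1 (λ σ → :0 :- (σ :- :1) := :1 :- σ) refl σ)) (proj₁ 0<δ)
      ... | inj₂ σ+δ≤1 = <⇒≰ 0<δ
        (≤-by (≤⇒0≤- σ+δ≤σ) (solve 2 (λ σ δ → :0 :- δ := σ :- (σ :+ δ)) refl σ δ))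
        where
        σ+δ≤σ : σ + δ ≤ᵣ σ
        σ+δ≤σ = upper (+-nonneg 0≤σ (proj₁ 0<δ) , σ+δ≤1 ,
          near (≤-reflexive (solve 2 (λ σ δ → (σ :+ δ) :- σ := δ) refl σ δ))
               (≤-by (+-nonneg (proj₁ 0<δ) (proj₁ 0<δ))
                 (solve 2 (λ σ δ → δ :- (σ :- (σ :+ δ)) := δ :+ δ) refl σ δ)))
      near-V : ¬ Near V
      -- A parameter of `A` within `δ` below `σ` would lie in both sets, so `σ - δ` would be a
      -- smaller upper bound.
      near-V (δ , 0<δ , near) = <⇒≰ 0<δ
        (≤-by (≤⇒0≤- (least bound)) (solve 2 (λ σ δ → :0 :- δ := (σ :- δ) :- σ) refl σ δ))
        where
        bound : ∀ {s} → 0# ≤ᵣ s × s ≤ᵣ 1# × segment p q s ∈ U → s ≤ᵣ σ - δ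
        bound {s} s∈A@(0≤s , s≤1 , ps∈U) with total s (σ - δ)
        ... | inj₁ s≤σ-δ = s≤σ-δ
        ... | inj₂ σ-δ≤s = contradiction (s , 0≤s , s≤1 , ps∈U , near s-σ≤δ σ-s≤δ) disjoint
          where
          s-σ≤δ : s - σ ≤ᵣ δ
          s-σ≤δ = ≤-trans (≤-by (≤⇒0≤- (upper s∈A)) (solve 2 (λ s σ → :0 :- (s :- σ) := σ :- s) refl s σ)) (proj₁ 0<δ)
          σ-s≤δ : σ - s ≤ᵣ δ
          σ-s≤δ = ≤-by (≤⇒0≤- σ-δ≤s) (solve 3 (λ s σ δ → δ :- (σ :- s) := s :- (σ :- δ)) refl s σ δ)
      case : segment p q σ ∈ U ∪ V → ⊥
      case (inj₁ pσ∈U) = near-U (segment-open open-U p q pσ∈U)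
      case (inj₂ pσ∈V) = near-V (segment-open open-V p q pσ∈V)

  -- Connected sets, components and rays.

  convex⇒connected : ∀ {n} {K : Region n} → IsConvex K → IsConnected K
  convex⇒connected convex U V open-U open-V K⊆U∪V (p , p∈K , p∈U) (q , q∈K , q∈V) disjoint =
    segment-connected open-U open-V p q p∈U q∈V
      (λ 0≤s s≤1 → K⊆U∪V (convex p q p∈K q∈K 0≤s s≤1))
      λ (s , 0≤s , s≤1 , ps∈U∩V) → disjoint (_ , convex p q p∈K q∈K 0≤s s≤1 , ps∈U∩V)

  -- The common point `z` lies in one of the two open sets. The given point of the other open set
  -- lies in `C` or `D`, and connectedness of that set, which also contains `z`, applies.
  ∪-connected : ∀ {n} {C D : Region n} {z} → IsConnected C → IsConnected D → z ∈ C → z ∈ D →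
                IsConnected (C ∪ D)
  ∪-connected {n} {C} {D} {z} conn-C conn-D z∈C z∈D U V open-U open-V ⊆U∪V (x , x∈ , x∈U) (y , y∈ , y∈V) disjoint
    with ⊆U∪V (inj₁ z∈C)
  ... | inj₁ z∈U = meet y∈
    where
    meet : y ∈ C ∪ D → ⊥
    meet (inj₁ y∈C) = conn-C U V open-U open-V (⊆U∪V ∘ inj₁) (z , z∈C , z∈U) (y , y∈C , y∈V)
      λ (w , w∈C , w∈U∩V) → disjoint (w , inj₁ w∈C , w∈U∩V)
    meet (inj₂ y∈D) = conn-D U V open-U open-V (⊆U∪V ∘ inj₂) (z , z∈D , z∈U) (y , y∈D , y∈V)
      λ (w , w∈D , w∈U∩V) → disjoint (w , inj₂ w∈D , w∈U∩V)
  ... | inj₂ z∈V = meet x∈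
    where
    meet : x ∈ C ∪ D → ⊥
    meet (inj₁ x∈C) = conn-C U V open-U open-V (⊆U∪V ∘ inj₁) (x , x∈C , x∈U) (z , z∈C , z∈V)
      λ (w , w∈C , w∈U∩V) → disjoint (w , inj₁ w∈C , w∈U∩V)
    meet (inj₂ x∈D) = conn-D U V open-U open-V (⊆U∪V ∘ inj₂) (x , x∈D , x∈U) (z , z∈D , z∈V)
      λ (w , w∈D , w∈U∩V) → disjoint (w , inj₂ w∈D , w∈U∩V)

  -- The union of `C` and `D` is connected and contained in `S`, so maximality of `C` applies to it.
  component-absorbs : ∀ {n} {S C D : Region n} {z} → IsComponent S C → IsConnected D → D ⊆ S →
                      z ∈ C → z ∈ D → D ⊆ C
  component-absorbs {S = S} {C} {D} (_ , C⊆S , conn-C , maximal) conn-D D⊆S z∈C z∈D x∈D =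
    maximal (C ∪ D) (∪-connected conn-C conn-D z∈C z∈D)
      (λ { (inj₁ x∈C) → C⊆S x∈C ; (inj₂ x∈D) → D⊆S x∈D }) inj₁ (inj₂ x∈D)

  ray : ∀ {n} → Point n → Point n → Carrier → Point n
  ray x v s i = x i + s * v i

  ray-between : ∀ {n} (x v : Point n) {s θ} → (1# + s) * θ ≈ 1# →
                ∀ i → x i ≈ segment (ray x v (- 1#)) (ray x v s) θ i
  ray-between x v {s} {θ} [1+s]θ≈1 i = sym (begin
    segment (ray x v (- 1#)) (ray x v s) θ i     ≈⟨ solve 4 (λ x v s θ →
      (x :+ (:- :1) :* v) :+ θ :* ((x :+ s :* v) :- (x :+ (:- :1) :* v)) :=
      (x :- v) :+ (:1 :+ s) :* θ :* v) refl (x i) (v i) s θ ⟩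
    (x i - v i) + (1# + s) * θ * v i             ≈⟨ +-congˡ (*-congʳ [1+s]θ≈1) ⟩
    (x i - v i) + 1# * v i                       ≈⟨ solve 2 (λ x v → (x :- v) :+ :1 :* v := x) refl (x i) (v i) ⟩
    x i                                          ∎)
    where open SetoidReasoning setoid

  -- In a coordinate where `v` does not vanish, `s` is chosen so that the coordinate of the ray
  -- becomes `M + 1` or `- (M + 1)`, according to the sign of `v i`. The bound at `s = 0` makes this
  -- `s` nonnegative.
  contains-ray⇒unbounded : ∀ {n} {C : Region n} (x v : Point n) → (∃ λ i → ¬ v i ≈ 0#) →
                           (∀ {s} → 0# ≤ᵣ s → ray x v s ∈ C) → ¬ IsBounded C
  contains-ray⇒unbounded x v (i , vᵢ≉0) ray⊆C (M , C≤M) = case (side (v i))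
    where
    k = proj₁ (inverse (v i) vᵢ≉0)
    vk≈1 = proj₂ (inverse (v i) vᵢ≉0)

    ∣coordinate∣≤M : ∀ {s} → 0# ≤ᵣ s → ∣ x i + s * v i ∣ ≤ᵣ M
    ∣coordinate∣≤M 0≤s = ≤-trans (∣∣≤‖‖ _ i) (C≤M _ (ray⊆C 0≤s))

    ∣x∣≤M : ∣ x i ∣ ≤ᵣ M
    ∣x∣≤M = ∣∣-cong-≤ (solve 2 (λ x v → x :+ :0 :* v := x) refl (x i) (v i)) (∣coordinate∣≤M ≤-refl)

    exceeds : ∀ {y} → y ≈ M + 1# → ¬ y ≤ᵣ M
    exceeds y≈M+1 y≤M = 1≰0
      (≤-by (≤⇒0≤- (≤-resp y≈M+1 refl y≤M)) (solve 1 (λ m → :0 :- :1 := m :- (m :+ :1)) refl M))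

    case : ∃ (λ τ → v i ∈ HalfLine τ) → ⊥
    case (nonnegative , 0≤v) = exceeds
      (begin
        x i + (M - x i + 1#) * k * v i ≈⟨ solve 4 (λ x m k v →
          x :+ (m :- x :+ :1) :* k :* v := x :+ (m :- x :+ :1) :* (v :* k)) refl (x i) M k (v i) ⟩
        x i + (M - x i + 1#) * (v i * k)  ≈⟨ +-congˡ (*-congˡ vk≈1) ⟩
        x i + (M - x i + 1#) * 1#         ≈⟨ solve 2 (λ x m → x :+ (m :- x :+ :1) :* :1 := m :+ :1) refl (x i) M ⟩
        M + 1#                            ∎)
      (≤-trans (x≤x⊔y _ _) (∣coordinate∣≤M
        (*-nonneg (+-nonneg (≤⇒0≤- (≤-trans (x≤x⊔y _ _) ∣x∣≤M)) 0≤1) (inverse-nonneg 0≤v vk≈1))))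
      where open SetoidReasoning setoid
    case (nonpositive , v≤0) = exceeds
      (begin
        - (x i + (M - - x i + 1#) * - k * v i) ≈⟨ solve 4 (λ x m k v →
          :- (x :+ (m :- :- x :+ :1) :* :- k :* v) := :- x :+ (m :+ x :+ :1) :* (v :* k)) refl (x i) M k (v i) ⟩
        - x i + (M + x i + 1#) * (v i * k)        ≈⟨ +-congˡ (*-congˡ vk≈1) ⟩
        - x i + (M + x i + 1#) * 1# ≈⟨ solve 2 (λ x m →
          :- x :+ (m :+ x :+ :1) :* :1 := m :+ :1) refl (x i) M ⟩
        M + 1#                                    ∎)
      (≤-trans (y≤x⊔y _ _) (∣coordinate∣≤M
        (*-nonneg (+-nonneg (≤⇒0≤- (≤-trans (y≤x⊔y _ _) ∣x∣≤M)) 0≤1)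
          (inverse-nonneg (x≤0⇒0≤-x v≤0)
            (trans (solve 2 (λ v k → (:- v) :* (:- k) := v :* k) refl (v i) k) vk≈1)))))
      where open SetoidReasoning setoid

-- Linear equations, solved with decidable propositions.

module LinearAlgebra (dec : (P : Set) → Dec P) (ℝ : CompleteOrderedField) where

  open CompleteOrderedField ℝ hiding (zero; _≤_; +-monoʳ-≤)
  open OrderedField ℝ
  open Topology ℝ
  open Euclidean ℝ
  open Sum semiring
    using (sum; sum-cong-≋; ∑-distrib-+; ∑-comm; *-distribˡ-sum; sum-remove; sum-replicate-zero)

  NonZero : ∀ {n} → Point n → Set
  NonZero v = ∃ λ i → ¬ v i ≈ 0#

  sum-linear : ∀ {n} (f g : Point n) s → sum (λ i → f i + s * g i) ≈ sum f + s * sum g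
  sum-linear f g s = trans (∑-distrib-+ f (λ i → s * g i)) (+-congˡ (sym (*-distribˡ-sum s g)))

  sum-zero : ∀ {n} {f : Point n} → (∀ i → f i ≈ 0#) → sum f ≈ 0#
  sum-zero {n} f≈0 = trans (sum-cong-≋ f≈0) (sum-replicate-zero n)

  sum-nonneg : ∀ {n} {f : Point n} → (∀ i → 0# ≤ᵣ f i) → 0# ≤ᵣ sum f
  sum-nonneg {zero}  0≤f = ≤-refl
  sum-nonneg {suc n} 0≤f = +-nonneg (0≤f zero) (sum-nonneg (0≤f ∘ suc))

  ·-congˡ : ∀ {n} (w : Point n) {x y : Point n} → (∀ i → x i ≈ y i) → w · x ≈ w · y
  ·-congˡ w x≋y = sum-cong-≋ (λ i → *-congˡ (x≋y i))

  ·-ray : ∀ {n} (w x v : Point n) s → w · ray x v s ≈ w · x + s * (w · v)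
  ·-ray w x v s = trans
    (sum-cong-≋ λ i → solve 4 (λ w x v s → w :* (x :+ s :* v) := w :* x :+ s :* (w :* v))
      refl (w i) (x i) (v i) s)
    (sum-linear (λ i → w i * x i) (λ i → w i * v i) s)

  ·-scale : ∀ {n} (w v : Point n) s → w · (λ i → s * v i) ≈ s * (w · v)
  ·-scale w v s = trans
    (sum-cong-≋ λ i → solve 3 (λ w v s → w :* (s :* v) := s :* (w :* v)) refl (w i) (v i) s)
    (sym (*-distribˡ-sum s (λ i → w i * v i)))

  ·-segment : ∀ {n} (w p q : Point n) s → w · segment p q s ≈ lerp (w · p) (w · q) s
  ·-segment w p q s = begin
    w · segment p q s                      ≈⟨ ·-ray w p (q -ᵥ p) s ⟩
    w · p + s * (w · (q -ᵥ p))             ≈⟨ +-congˡ (*-congˡ (·-congˡ w λ i →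
      solve 2 (λ p q → q :- p := q :+ (:- :1) :* p) refl (p i) (q i))) ⟩
    w · p + s * (w · ray q p (- 1#))       ≈⟨ +-congˡ (*-congˡ (·-ray w q p (- 1#))) ⟩
    w · p + s * (w · q + - 1# * (w · p))   ≈⟨ solve 3 (λ a b s →
      a :+ s :* (b :+ (:- :1) :* a) := a :+ s :* (b :- a)) refl (w · p) (w · q) s ⟩
    lerp (w · p) (w · q) s                 ∎
    where open SetoidReasoning setoid

  ·-insertAt : ∀ {n} (w : Point (suc n)) (x : Point n) k c →
               w · insertAt x k c ≈ w k * c + removeAt w k · x
  ·-insertAt w x k c = trans (sum-remove {i = k} (λ i → w i * insertAt x k c i))
    (+-cong (*-congˡ (reflexive (insertAt-lookup x k c)))
      (sum-cong-≋ λ i → *-congˡ (reflexive (insertAt-punchIn x k c i))))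

  -- Gaussian elimination by induction on the number of equations. If the first row is zero, the
  -- first unknown is set to zero; otherwise a nonzero entry of that row serves as pivot.
  kernel-nontrivial : ∀ {n} (A : Fin n → Point (suc n)) →
                      ∃ λ z → NonZero z × (∀ j → A j · z ≈ 0#)
  kernel-nontrivial {zero}  A = (λ _ → 1#) , (zero , 0≉1 ∘ sym) , λ ()
  kernel-nontrivial {suc n} A with dec (NonZero (A zero))
  ... | no A₀≈0 = 0# ∷ z , (suc i , zᵢ≉0) , λ
    { zero    → sum-zero λ i → trans (*-congʳ (A₀ᵢ≈0 i)) (zeroˡ ((0# ∷ z) i))
    ; (suc j) → trans (+-congʳ (zeroʳ _)) (trans (+-identityˡ _) (Az≈0 j)) }
    where
    A₀ᵢ≈0 : ∀ i → A zero i ≈ 0#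
    A₀ᵢ≈0 i = decidable-stable (dec _) λ A₀ᵢ≉0 → A₀≈0 (i , A₀ᵢ≉0)
    rest = kernel-nontrivial (λ j → tail (A (suc j)))
    z = proj₁ rest
    i = proj₁ (proj₁ (proj₂ rest))
    zᵢ≉0 = proj₂ (proj₁ (proj₂ rest))
    Az≈0 = proj₂ (proj₂ rest)
  ... | yes (k , A₀ₖ≉0) = insertAt z k c , nonzero , vanishes
    where
    a = proj₁ (inverse (A zero k) A₀ₖ≉0)
    A₀ₖa≈1 = proj₂ (inverse (A zero k) A₀ₖ≉0)
    A₀ = removeAt (A zero) k
    reduced : Fin n → Point (suc n)
    -- Subtracts the multiple of the pivot row that cancels the unknown `k`, whose column is then
    -- dropped.
    reduced j = ray (removeAt (A (suc j)) k) A₀ (- (A (suc j) k * a))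
    rest = kernel-nontrivial reduced
    z = proj₁ rest
    -- The value that the pivot row forces on the unknown `k`.
    c = - (a * (A₀ · z))
    nonzero : NonZero (insertAt z k c)
    nonzero with proj₁ (proj₂ rest)
    ... | i , zᵢ≉0 = punchIn k i , λ e → zᵢ≉0 (trans (reflexive (≡.sym (insertAt-punchIn z k c i))) e)
    reduced-· : ∀ j → reduced j · z ≈ removeAt (A (suc j)) k · z + - (A (suc j) k * a) * (A₀ · z)
    reduced-· j = trans (·-comm (reduced j) z)
      (trans (·-ray z Aⱼ A₀ _) (+-cong (·-comm z Aⱼ) (*-congˡ (·-comm z A₀))))
      where
      Aⱼ = removeAt (A (suc j)) k
      ·-comm : ∀ {n} (x y : Point n) → x · y ≈ y · x
      ·-comm x y = sum-cong-≋ λ i → *-comm (x i) (y i)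
    vanishes : ∀ j → A j · insertAt z k c ≈ 0#
    vanishes zero = begin
      A zero · insertAt z k c                     ≈⟨ ·-insertAt (A zero) z k c ⟩
      A zero k * - (a * (A₀ · z)) + A₀ · z ≈⟨ solve 3 (λ x a s →
        x :* :- (a :* s) :+ s := (:1 :- x :* a) :* s) refl (A zero k) a (A₀ · z) ⟩
      (1# - A zero k * a) * (A₀ · z)              ≈⟨ *-congʳ (trans (+-congˡ (-‿cong A₀ₖa≈1)) (-‿inverseʳ 1#)) ⟩
      0# * (A₀ · z)                               ≈⟨ zeroˡ _ ⟩
      0#                                          ∎
      where open SetoidReasoning setoid
    vanishes (suc j) = begin
      A (suc j) · insertAt z k c                  ≈⟨ ·-insertAt (A (suc j)) z k c ⟩
      A (suc j) k * - (a * (A₀ · z)) + Aⱼ · z ≈⟨ solve 4 (λ x a s t →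
        x :* :- (a :* s) :+ t := t :+ :- (x :* a) :* s) refl (A (suc j) k) a (A₀ · z) (Aⱼ · z) ⟩
      Aⱼ · z + - (A (suc j) k * a) * (A₀ · z)     ≈⟨ sym (reduced-· j) ⟩
      reduced j · z                               ≈⟨ proj₂ (proj₂ rest) j ⟩
      0#                                          ∎
      where
      open SetoidReasoning setoid
      Aⱼ = removeAt (A (suc j)) k

  -- Exchanging the two sums moves `l` onto the columns of `W`, where it vanishes.
  relation-· : ∀ {m n} (W : Fin m → Point n) (l : Point m) →
               (∀ i → sum (λ j → l j * W j i) ≈ 0#) → ∀ v → l · (λ j → W j · v) ≈ 0#
  relation-· W l lW≈0 v = begin
    sum (λ j → l j * (W j · v))                  ≈⟨ sum-cong-≋ (λ j → *-distribˡ-sum (l j) (λ i → W j i * v i)) ⟩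
    sum (λ j → sum λ i → l j * (W j i * v i))    ≈⟨ ∑-comm (λ j i → l j * (W j i * v i)) ⟩
    sum (λ i → sum λ j → l j * (W j i * v i))    ≈⟨ sum-cong-≋ (λ i → sum-cong-≋ λ j →
      solve 3 (λ l w v → l :* (w :* v) := v :* (l :* w)) refl (l j) (W j i) (v i)) ⟩
    sum (λ i → sum λ j → v i * (l j * W j i))    ≈⟨ sum-zero (λ i →
      trans (sym (*-distribˡ-sum (v i) (λ j → l j * W j i))) (trans (*-congˡ (lW≈0 i)) (zeroʳ _))) ⟩
    0#                                           ∎
    where open SetoidReasoning setoid

  -- Only the term `l k * e k` of the product `l · e` survives, and `l k` can be cancelled.
  orthogonal⇒zero : ∀ {n} (l e : Point (suc n)) k → ¬ l k ≈ 0# → l · e ≈ 0# →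
                    (∀ j → e (punchIn k j) ≈ 0#) → ∀ j → e j ≈ 0#
  orthogonal⇒zero l e k lₖ≉0 l·e≈0 e≈0 j with k Fin.≟ j
  ... | no k≢j = trans (reflexive (≡.cong e (≡.sym (Fin.punchIn-punchOut k≢j)))) (e≈0 _)
  ... | yes ≡.refl = *-cancelˡ-≈0 lₖ≉0 (begin
    l k * e k                                     ≈⟨ sym (+-identityʳ _) ⟩
    l k * e k + 0#                                ≈⟨ +-congˡ (sym (sum-zero λ i → trans (*-congˡ (e≈0 i)) (zeroʳ _))) ⟩
    l k * e k + removeAt l k · removeAt e k       ≈⟨ sym (sum-remove {i = k} (λ i → l i * e i)) ⟩
    l · e                                         ≈⟨ l·e≈0 ⟩
    0#                                            ∎)
    where open SetoidReasoning setoid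

  -- A nontrivial solution (τ , v) of the n equations W j · v ≈ τ * d j with j ≠ k
  -- solves the k-th equation too, because l is orthogonal to W v and to d.
  kernel-or-surjective :
    ∀ {n} (W : Fin (suc n) → Point n) (l : Point (suc n)) → NonZero l →
    (∀ i → sum (λ j → l j * W j i) ≈ 0#) → ∀ d → l · d ≈ 0# →
    (∃ λ v → NonZero v × (∀ j → W j · v ≈ 0#)) ⊎ (∃ λ v → ∀ j → W j · v ≈ d j)
  kernel-or-surjective {n} W l (k , lₖ≉0) lW≈0 d l·d≈0 = conclude (dec (τ ≈ 0#))
    where
    solution = kernel-nontrivial (λ j → (- d (punchIn k j)) ∷ W (punchIn k j))
    τ = proj₁ solution zero
    v = tail (proj₁ solution)

    e : Point (suc n)
    e j = W j · v + - τ * d j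

    l·e≈0 : l · e ≈ 0#
    l·e≈0 = begin
      l · e                                 ≈⟨ ·-ray l (λ j → W j · v) d (- τ) ⟩
      l · (λ j → W j · v) + - τ * (l · d)   ≈⟨ +-cong (relation-· W l lW≈0 v) (*-congˡ l·d≈0) ⟩
      0# + - τ * 0#                         ≈⟨ solve 1 (λ t → :0 :+ (:- t) :* :0 := :0) refl τ ⟩
      0#                                    ∎
      where open SetoidReasoning setoid

    e≈0 : ∀ j → e j ≈ 0#
    e≈0 = orthogonal⇒zero l e k lₖ≉0 l·e≈0 λ j →
      trans (solve 3 (λ w t d → w :+ (:- t) :* d := (:- d) :* t :+ w) refl _ τ _)
        (proj₂ (proj₂ solution) j)

    Wv≈τd : ∀ j → W j · v ≈ τ * d j
    Wv≈τd j = begin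
      W j · v         ≈⟨ solve 3 (λ w t d → w := (w :+ (:- t) :* d) :+ t :* d) refl (W j · v) τ (d j) ⟩
      e j + τ * d j   ≈⟨ +-congʳ (e≈0 j) ⟩
      0# + τ * d j    ≈⟨ +-identityˡ _ ⟩
      τ * d j         ∎
      where open SetoidReasoning setoid

    conclude : Dec (τ ≈ 0#) → _
    -- With `τ` zero, the nonzero entry of the solution must belong to `v`, a kernel vector.
    -- Otherwise `v` divided by `τ` is a preimage of `d`.
    conclude (yes τ≈0) =
      inj₁ (v , nonzero (proj₁ (proj₂ solution)) , λ j → trans (Wv≈τd j) (trans (*-congʳ τ≈0) (zeroˡ _)))
      where
      nonzero : NonZero (proj₁ solution) → NonZero v
      nonzero (zero  , τ≉0)  = contradiction τ≈0 τ≉0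
      nonzero (suc i , vᵢ≉0) = i , vᵢ≉0
    conclude (no τ≉0) = inj₂ ((λ i → a * v i) , λ j → begin
      W j · (λ i → a * v i)   ≈⟨ ·-scale (W j) v a ⟩
      a * (W j · v)           ≈⟨ *-congˡ (Wv≈τd j) ⟩
      a * (τ * d j)           ≈⟨ solve 3 (λ a t d → a :* (t :* d) := t :* a :* d) refl a τ (d j) ⟩
      τ * a * d j             ≈⟨ *-congʳ (proj₂ (inverse τ τ≉0)) ⟩
      1# * d j                ≈⟨ *-identityˡ _ ⟩
      d j                     ∎)
      where
      open SetoidReasoning setoid
      a = proj₁ (inverse τ τ≉0)

-- Closed cells of the network and decision regions.

module DecisionRegions (dec : (P : Set) → Dec P) (ℝ : CompleteOrderedField) where

  open CompleteOrderedField ℝ hiding (zero; _≤_; +-monoʳ-≤)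
  open OrderedField ℝ
  open Topology ℝ
  open LinearAlgebra dec ℝ
  open NeuralNetwork ℝ hiding (Y; N)
  open Sum semiring using (sum; sum-cong-≋; *-distribˡ-sum)

  module _ {n m : ℕ} (F : ReLUNetwork n m) where

    y : Fin m → Point n → Carrier
    y j x = apply (hidden F) x j

    -- A closed sign region of all preactivations, constant ones included. It may be empty or of
    -- lower dimension.
    Cell : (Fin m → Side) → Region n
    Cell τ x = ∀ j → y j x ∈ HalfLine (τ j)

    y-ray : ∀ x v s j → y j (ray x v s) ≈ y j x + s * (weight (hidden F) j · v)
    y-ray x v s j = trans (+-congʳ (·-ray (weight (hidden F) j) x v s))
      (solve 3 (λ w t b → (w :+ t) :+ b := (w :+ b) :+ t) refl _ _ _)

    y-segment : ∀ p q s j → y j (segment p q s) ≈ lerp (y j p) (y j q) s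
    y-segment p q s j = trans (+-congʳ (·-segment (weight (hidden F) j) p q s))
      (solve 4 (λ u v s b → (u :+ s :* (v :- u)) :+ b := (u :+ b) :+ s :* ((v :+ b) :- (u :+ b)))
        refl _ _ s _)

    y-cong : ∀ {p q} → (∀ i → p i ≈ q i) → ∀ j → y j p ≈ y j q
    y-cong p≋q j = +-congʳ (·-congˡ (weight (hidden F) j) p≋q)

    eval-cong : ∀ {p q} → (∀ j → y j p ≈ y j q) → eval F p ≈ eval F q
    eval-cong yp≈yq = +-congʳ (·-congˡ (weight (output F) zero) λ j → ⊔-congˡ 0# (yp≈yq j))

    -- Inside a cell each preactivation keeps to one half-line, where ReLU respects interpolation;
    -- the output map is affine.
    eval-segment : ∀ τ {p q s} → p ∈ Cell τ → q ∈ Cell τ → 0# ≤ᵣ s → s ≤ᵣ 1# →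
                   eval F (segment p q s) ≈ lerp (eval F p) (eval F q) s
    eval-segment τ {p} {q} {s} p∈ q∈ 0≤s s≤1 = begin
      a · ReLUs (segment p q s) + b                 ≈⟨ +-congʳ (·-congˡ a λ j →
        trans (⊔-congˡ 0# (y-segment p q s j)) (ReLU-lerp (τ j) (p∈ j) (q∈ j) 0≤s s≤1)) ⟩
      a · segment (ReLUs p) (ReLUs q) s + b         ≈⟨ +-congʳ (·-segment a (ReLUs p) (ReLUs q) s) ⟩
      lerp (a · ReLUs p) (a · ReLUs q) s + b        ≈⟨ solve 4 (λ u v s b →
        (u :+ s :* (v :- u)) :+ b := (u :+ b) :+ s :* ((v :+ b) :- (u :+ b)))
        refl (a · ReLUs p) (a · ReLUs q) s b ⟩
      lerp (eval F p) (eval F q) s                  ∎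
      where
      open SetoidReasoning setoid
      a = weight (output F) zero
      b = bias (output F) zero
      ReLUs : Point n → Point m
      ReLUs x j = ReLU (y j x)

    Cell-convex : ∀ τ → IsConvex (Cell τ)
    Cell-convex τ p q {s} p∈ q∈ 0≤s s≤1 j =
      HalfLine-resp (τ j) (sym (y-segment p q s j)) (HalfLine-convex (τ j) (p∈ j) (q∈ j) 0≤s s≤1)

    module _ {H : Pred Carrier 0ℓ} (H-resp : H Respects _≈_) (H-convex : IsConvexSet H) where

      Cell∩preimage-connected : ∀ τ → IsConnected (Cell τ ∩ (λ x → eval F x ∈ H))
      Cell∩preimage-connected τ = convex⇒connected λ p q (p∈ , p∈H) (q∈ , q∈H) 0≤s s≤1 →
        Cell-convex τ p q p∈ q∈ 0≤s s≤1 ,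
        H-resp (sym (eval-segment τ p∈ q∈ 0≤s s≤1)) (H-convex p∈H q∈H 0≤s s≤1)

      component-absorbs-cell : ∀ τ {C : Region n} {p q} → IsComponent (λ x → eval F x ∈ H) C →
        p ∈ C → p ∈ Cell τ → q ∈ Cell τ → eval F q ∈ H → q ∈ C
      component-absorbs-cell τ comp p∈C p∈ q∈ q∈H =
        component-absorbs comp (Cell∩preimage-connected τ) proj₂ p∈C
          (p∈ , proj₁ (proj₂ comp) p∈C) (q∈ , q∈H)

  -- A preactivation y on the wrong side of zero has factor 1, so that it is sent to zero, and
  -- any other has factor ρ.  P and N are the positive and the negative part of l * y.
  record Contraction (l y : Carrier) (σ : Side) : Set where
    field
      P N      : Carrier
      0≤P      : 0# ≤ᵣ P
      0≤N      : 0# ≤ᵣ N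
      P-N≈ly   : P + - 1# * N ≈ l * y
      factor   : Carrier → Carrier
      0≤factor : ∀ {ρ} → 0# ≤ᵣ ρ → 0# ≤ᵣ factor ρ
      factor≤1 : ∀ {ρ} → ρ ≤ᵣ 1# → factor ρ ≤ᵣ 1#
      -- Summed over the coordinates, the right side vanishes once `ρ` times the total of `P` equals
      -- the total of `N`.
      balance  : ∀ ρ → l * (factor ρ * y) ≈ ρ * P + - 1# * N
      lands    : ∀ {ρ} → ρ ≤ᵣ 1# → (1# - factor ρ) * y ∈ HalfLine σ

  contraction : ∀ {l y} σ → l ∈ HalfLine σ → Dec (y ∈ HalfLine σ) → Contraction l y σ
  contraction {l} {y} σ l∈σ (yes y∈σ) = record
    { P = l * y ; N = 0# ; 0≤P = HalfLine-* σ l∈σ y∈σ ; 0≤N = ≤-refl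
    ; P-N≈ly = solve 1 (λ p → p :+ (:- :1) :* :0 := p) refl (l * y)
    ; factor = λ ρ → ρ
    ; 0≤factor = λ 0≤ρ → 0≤ρ
    ; factor≤1 = λ ρ≤1 → ρ≤1
    ; balance = λ ρ → solve 3 (λ l y ρ → l :* (ρ :* y) := ρ :* (l :* y) :+ (:- :1) :* :0) refl l y ρ
    ; lands = λ ρ≤1 → HalfLine-scale σ (≤⇒0≤- ρ≤1) y∈σ
    }
  contraction {l} {y} σ l∈σ (no y∉σ) = record
    { P = 0# ; N = - (l * y) ; 0≤P = ≤-refl ; 0≤N = x≤0⇒0≤-x (HalfLine-*-∉ σ l∈σ y∉σ)
    ; P-N≈ly = solve 1 (λ p → :0 :+ (:- :1) :* (:- p) := p) refl (l * y)
    ; factor = λ _ → 1#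
    ; 0≤factor = λ _ → 0≤1
    ; factor≤1 = λ _ → ≤-refl
    ; balance = λ ρ → solve 3 (λ l y ρ → l :* (:1 :* y) := ρ :* :0 :+ (:- :1) :* (:- (l :* y))) refl l y ρ
    ; lands = λ _ → HalfLine-resp σ (solve 1 (λ y → :0 := (:1 :- :1) :* y) refl y) (0∈HalfLine σ)
    }

  -- A linear dependence among the `n + 1` weight rows. The normalization `0≤l·b` makes the total
  -- negative part of the terms `l j * y j` at most the total positive part.
  record Relation {n : ℕ} (F : ReLUNetwork n (suc n)) : Set where
    field
      l       : Point (suc n)
      nonzero : NonZero l
      lW≈0    : ∀ i → sum (λ j → l j * weight (hidden F) j i) ≈ 0#
      0≤l·b   : 0# ≤ᵣ l · bias (hidden F)

  relation : ∀ {n} (F : ReLUNetwork n (suc n)) → Relation F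
  relation F with kernel-nontrivial (λ i j → weight (hidden F) j i)
  ... | l , l≉0@(k , lₖ≉0) , Wᵀl≈0 with total 0# (l · bias (hidden F))
  ...   | inj₁ 0≤l·b = record
    { l = l ; nonzero = l≉0 ; 0≤l·b = 0≤l·b
    ; lW≈0 = λ i → trans (sum-cong-≋ λ j → *-comm (l j) (weight (hidden F) j i)) (Wᵀl≈0 i) }
  -- Negating `l` keeps the dependence and reverses the sign of `l · b`.
  ...   | inj₂ l·b≤0 = record
    { l = λ j → - 1# * l j
    ; nonzero = k , λ -lₖ≈0 → lₖ≉0 (trans (solve 1 (λ l → l := (:- :1) :* ((:- :1) :* l)) refl (l k))
        (trans (*-congˡ -lₖ≈0) (zeroʳ (- 1#))))
    ; 0≤l·b = ≤-respʳ (sym (negate (bias (hidden F)))) (x≤0⇒0≤-x l·b≤0)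
    ; lW≈0 = λ i → trans (negate (λ j → weight (hidden F) j i))
        (trans (-‿cong (trans (sum-cong-≋ λ j → *-comm (l j) (weight (hidden F) j i)) (Wᵀl≈0 i)))
          (solve 0 (:- :0 := :0) refl)) }
    where
    negate : ∀ b → sum (λ j → (- 1# * l j) * b j) ≈ - sum (λ j → l j * b j)
    negate b = trans (sum-cong-≋ λ j → *-assoc (- 1#) (l j) (b j))
      (trans (sym (*-distribˡ-sum (- 1#) (λ j → l j * b j)))
        (solve 1 (λ s → (:- :1) :* s := :- s) refl _))

  -- Contraction of bounded components into a common cell.

  module _ {n : ℕ} (F : ReLUNetwork n (suc n)) (R : Relation F) {H : Pred Carrier 0ℓ} (H-resp : H Respects _≈_)
           (H-convex : IsConvexSet H) (Hᶜ-convex : IsConvexSet (λ a → ¬ a ∈ H)) where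

    private
      W = weight (hidden F)
      open Relation R

      S : Region n
      S x = eval F x ∈ H

      -- The signs defining the cell Δ. Where `l j` is zero, either side serves.
      σ : Fin (suc n) → Side
      σ j = proj₁ (side (l j))

    l·y≈l·b : ∀ x → l · (λ j → y F j x) ≈ l · bias (hidden F)
    l·y≈l·b x = begin
      l · (λ j → W j · x + bias (hidden F) j)              ≈⟨ ·-congˡ l (λ j → +-congˡ {W j · x} (sym (*-identityˡ (bias (hidden F) j)))) ⟩
      l · ray (λ j → W j · x) (bias (hidden F)) 1#         ≈⟨ ·-ray l (λ j → W j · x) (bias (hidden F)) 1# ⟩
      l · (λ j → W j · x) + 1# * (l · bias (hidden F))     ≈⟨ +-cong (relation-· W l lW≈0 x) (*-identityˡ _) ⟩
      0# + l · bias (hidden F)                             ≈⟨ +-identityˡ _ ⟩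
      l · bias (hidden F)                                  ∎
      where open SetoidReasoning setoid

    -- The vector with entries `c j * y F j x` is the intended value of `W v`; orthogonality to `l`
    -- is what makes it attainable when `W` has trivial kernel. The entries `(1# - c j) * y F j x`
    -- are then the preactivations of `x - v`.
    ContractionFactors : Point n → Set
    ContractionFactors x = ∃ λ (c : Point (suc n)) →
      (∀ j → 0# ≤ᵣ c j × c j ≤ᵣ 1# × (1# - c j) * y F j x ∈ HalfLine (σ j)) ×
      l · (λ j → c j * y F j x) ≈ 0#

    contractionFactors : ∀ x → ContractionFactors x
    contractionFactors x =
      (λ j → K.factor j ρ) , (λ j → K.0≤factor j 0≤ρ , K.factor≤1 j ρ≤1 , K.lands j ρ≤1) , balanced
      where
      module K j = Contraction (contraction (σ j) (proj₂ (side (l j))) (dec (y F j x ∈ HalfLine (σ j))))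
      ΣP-ΣN≈l·b : sum K.P + - 1# * sum K.N ≈ l · bias (hidden F)
      ΣP-ΣN≈l·b = trans (sym (sum-linear K.P K.N (- 1#))) (trans (sum-cong-≋ K.P-N≈ly) (l·y≈l·b x))
      ΣN≤ΣP : sum K.N ≤ᵣ sum K.P
      ΣN≤ΣP = ≤-by 0≤l·b
        (trans (solve 2 (λ p n → p :- n := p :+ (:- :1) :* n) refl (sum K.P) (sum K.N)) ΣP-ΣN≈l·b)
      -- The factor `ρ` shrinks the total positive part to the total negative part.
      scale = ratio (dec (sum K.P ≈ 0#)) (sum-nonneg K.0≤N) ΣN≤ΣP
      ρ = proj₁ scale
      0≤ρ = proj₁ (proj₂ scale)
      ρ≤1 = proj₁ (proj₂ (proj₂ scale))
      balanced : l · (λ j → K.factor j ρ * y F j x) ≈ 0#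
      balanced = begin
        l · (λ j → K.factor j ρ * y F j x)              ≈⟨ sum-cong-≋ (λ j → K.balance j ρ) ⟩
        sum (λ j → ρ * K.P j + - 1# * K.N j)            ≈⟨ sum-linear (λ j → ρ * K.P j) K.N (- 1#) ⟩
        sum (λ j → ρ * K.P j) + - 1# * sum K.N          ≈⟨ +-congʳ (sym (*-distribˡ-sum ρ K.P)) ⟩
        ρ * sum K.P + - 1# * sum K.N                    ≈⟨ +-congʳ (proj₂ (proj₂ (proj₂ scale))) ⟩
        sum K.N + - 1# * sum K.N                        ≈⟨ solve 1 (λ n → n :+ (:- :1) :* n := :0) refl (sum K.N) ⟩
        0#                                              ∎
        where open SetoidReasoning setoid

    -- Boundedness of `C` excludes a kernel vector of `W` and a ray from `x` along `v` that stays in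
    -- `S`. What remains is that the endpoint `x - v` lies in `S`, hence in `C`.
    bounded-component-meets-cell : ∀ {C} → IsComponent S C → IsBounded C → ∃ λ q → q ∈ C × q ∈ Cell F σ
    bounded-component-meets-cell {C} comp@((x , x∈C) , C⊆S , _) bounded =
      contract (contractionFactors x)
      where
      τ : Fin (suc n) → Side
      τ j = proj₁ (side (y F j x))
      x∈τ : x ∈ Cell F τ
      x∈τ j = proj₂ (side (y F j x))

      absorb : ∀ {z} → z ∈ Cell F τ → z ∈ S → z ∈ C
      absorb = component-absorbs-cell F H-resp H-convex τ comp x∈C x∈τ

      contract : ContractionFactors x → ∃ λ q → q ∈ C × q ∈ Cell F σ
      contract (c , c-bounds , l·d≈0) =
        conclude (kernel-or-surjective W l nonzero lW≈0 (λ j → c j * y F j x) l·d≈0)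
        where
        conclude : (∃ λ v → NonZero v × (∀ j → W j · v ≈ 0#)) ⊎ (∃ λ v → ∀ j → W j · v ≈ c j * y F j x) →
                   ∃ λ q → q ∈ C × q ∈ Cell F σ
        -- All preactivations, and hence `F`, are constant along a kernel vector.
        conclude (inj₁ (v , v≉0 , Wv≈0)) = contradiction bounded
          (contains-ray⇒unbounded x v v≉0 λ {s} _ → absorb
            (λ j → HalfLine-resp (τ j) (same s j) (x∈τ j))
            (H-resp (eval-cong F (same s)) (C⊆S x∈C)))
          where
          same : ∀ s j → y F j x ≈ y F j (ray x v s)
          same s j = sym (trans (y-ray F x v s j)
            (trans (+-congˡ (trans (*-congˡ (Wv≈0 j)) (zeroʳ s))) (+-identityʳ _)))
        conclude (inj₂ (v , Wv≈d)) = by-endpoint (dec (q ∈ S))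
          where
          q : Point n
          q = ray x v (- 1#)

          -- As `c j` lies between zero and one, the factor `1# + s * c j` is nonnegative for all
          -- `s` from `-1` on, so no preactivation changes sign along the ray.
          y-along : ∀ s j → y F j (ray x v s) ≈ (1# + s * c j) * y F j x
          y-along s j = begin
            y F j (ray x v s)                  ≈⟨ y-ray F x v s j ⟩
            y F j x + s * (W j · v)            ≈⟨ +-congˡ (*-congˡ (Wv≈d j)) ⟩
            y F j x + s * (c j * y F j x) ≈⟨ solve 3 (λ y s c →
              y :+ s :* (c :* y) := (:1 :+ s :* c) :* y) refl (y F j x) s (c j) ⟩
            (1# + s * c j) * y F j x           ∎
            where open SetoidReasoning setoid

          y-q : ∀ j → (1# - c j) * y F j x ≈ y F j q
          y-q j = sym (trans (y-along (- 1#) j)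
            (*-congʳ (solve 1 (λ c → :1 :+ (:- :1) :* c := :1 :- c) refl (c j))))

          q∈τ : q ∈ Cell F τ
          q∈τ j = HalfLine-resp (τ j) (y-q j)
            (HalfLine-scale (τ j) (≤⇒0≤- (proj₁ (proj₂ (c-bounds j)))) (x∈τ j))

          ray∈τ : ∀ {s} → 0# ≤ᵣ s → ray x v s ∈ Cell F τ
          ray∈τ {s} 0≤s j = HalfLine-resp (τ j) (sym (y-along s j))
            (HalfLine-scale (τ j) (+-nonneg 0≤1 (*-nonneg 0≤s (proj₁ (c-bounds j)))) (x∈τ j))

          -- x lies between q and ray x v s, so one of these two lies in S.
          ray∈S : ¬ q ∈ S → ∀ {s} → 0# ≤ᵣ s → ray x v s ∈ S
          ray∈S q∉S {s} 0≤s = decidable-stable (dec _) (between (inverse-1+ 0≤s))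
            where
            between : (∃ λ θ → 0# ≤ᵣ θ × θ ≤ᵣ 1# × (1# + s) * θ ≈ 1#) → ¬ ¬ ray x v s ∈ S
            between (θ , 0≤θ , θ≤1 , [1+s]θ≈1) r∉S = Hᶜ-convex q∉S r∉S 0≤θ θ≤1 (H-resp
              (trans (eval-cong F (y-cong F (ray-between x v [1+s]θ≈1)))
                (eval-segment F τ q∈τ (ray∈τ 0≤s) 0≤θ θ≤1))
              (C⊆S x∈C))

          -- If `v` were zero, `q` would equal `x`, which lies in `S`.
          v≉0 : ¬ q ∈ S → NonZero v
          v≉0 q∉S = decidable-stable (dec _) λ v≈0 → q∉S (H-resp (eval-cong F (y-cong F λ i → sym
            (trans (+-congˡ (trans (*-congˡ (decidable-stable (dec _) λ vᵢ≉0 → v≈0 (i , vᵢ≉0)))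
              (zeroʳ (- 1#)))) (+-identityʳ (x i))))) (C⊆S x∈C))

          by-endpoint : Dec (q ∈ S) → ∃ λ q → q ∈ C × q ∈ Cell F σ
          by-endpoint (yes q∈S) =
            q , absorb q∈τ q∈S , λ j → HalfLine-resp (σ j) (y-q j) (proj₂ (proj₂ (c-bounds j)))
          by-endpoint (no q∉S) = contradiction bounded
            (contains-ray⇒unbounded x v (v≉0 q∉S) λ 0≤s → absorb (ray∈τ 0≤s) (ray∈S q∉S 0≤s))

    -- Both components meet the connected set `Cell F σ ∩ S`, so they share a point and absorb each
    -- other.
    atMostOneBoundedComponent : AtMostOneBoundedComponent S
    atMostOneBoundedComponent C D comp-C@(_ , C⊆S , conn-C , _) bounded-C comp-D@(_ , D⊆S , conn-D , _) bounded-D =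
      compare (bounded-component-meets-cell comp-C bounded-C) (bounded-component-meets-cell comp-D bounded-D)
      where
      compare : (∃ λ p → p ∈ C × p ∈ Cell F σ) → (∃ λ q → q ∈ D × q ∈ Cell F σ) → C ≐ D
      compare (p , p∈C , p∈σ) (q , q∈D , q∈σ) =
        component-absorbs comp-D conn-C C⊆S q∈D q∈C , component-absorbs comp-C conn-D D⊆S q∈C q∈D
        where
        q∈C : q ∈ C
        q∈C = component-absorbs-cell F H-resp H-convex σ comp-C p∈C p∈σ q∈σ (D⊆S q∈D)

  ≮⇒≥ : ∀ {a b} → ¬ a < b → b ≤ᵣ a
  ≮⇒≥ a≮b = decidable-stable (dec _) (a≮b ∘ ≰⇒>)

  >-coconvex : ∀ {t} → IsConvexSet (λ a → ¬ t < a)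
  >-coconvex t≮a t≮b 0≤s s≤1 t<c = <⇒≰ t<c (lerp-upper (≮⇒≥ t≮a) (≮⇒≥ t≮b) 0≤s s≤1)

  <-coconvex : ∀ {t} → IsConvexSet (λ a → ¬ a < t)
  <-coconvex a≮t b≮t 0≤s s≤1 c<t = <⇒≰ c<t (lerp-lower (≮⇒≥ a≮t) (≮⇒≥ b≮t) 0≤s s≤1)

theorem6 :
    ExcludedMiddle (lsuc 0ℓ) →
    (ℝ : CompleteOrderedField) →
    let open CompleteOrderedField ℝ using (Carrier)
        open NeuralNetwork ℝ in
    (n : ℕ) → 1 ≤ n →
    (F : ReLUNetwork n (suc n)) (t : Carrier) →
    IsTransversalThreshold F t →
    AtMostOneBoundedComponent (Y F t) × AtMostOneBoundedComponent (N F t)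
theorem6 em ℝ n _ F t _ =
  -- Both regions are preimages of open half-lines, which are convex and have convex complements.
  atMostOneBoundedComponent F (relation F) (<-resp refl) >-convex >-coconvex ,
  atMostOneBoundedComponent F (relation F) (λ p → <-resp p refl) <-convex <-coconvex
  where
  open CompleteOrderedField ℝ using (refl)
  dec : (P : Set) → Dec P
  dec P = map′ lower lift (em {Lift (lsuc 0ℓ) P})
  open OrderedField ℝ
  open DecisionRegions dec ℝ
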